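{- Let $n$ be a positive integer and let $x$ be a nonzero complex number such that $x^m\neq 1$ for every positive integer $m<n$. Let $A=(a_{ij})$ be the $n\times n$ matrix with \[ a_{ij}=(1-\delta_{ij})\left(1-\frac{1}{1-x^{i-j}}\right), \] where $\delta_{ij}=1$ if $i=j$ and $0$ otherwise. Let $k$ be an integer with $0\le k<n$, let $1\le s_1<s_2<\cdots<s_k\le n$, and let $B=(b_{ij})$ be the $(n-k)\times(n-k)$ matrix obtained from $A$ by deleting the rows and the columns with indices $s_1,\dots,s_k$ (indexed by $1,\dots,n-k$). \begin{enumerate} \item If $n-k$ is odd, then \[ \sum_{\substack{\tau\in D(n-k)\\ \operatorname{sign}(\tau)=1}}\prod_{j=1}^{n-k}b_{j\tau(j)}=\sum_{\substack{\tau\in D(n-k)\\ \operatorname{sign}(\tau)=-1}}\prod_{j=1}^{n-k}b_{j\tau(j)}=0. \] \item If $n-k$ is even, then \[ \sum_{\substack{\tau\in D(n-k)\\ \operatorname{sign}(\tau)=(-1)^{\frac{n-k}{2}+1}}}\prod_{j=1}^{n-k}b_{j\tau(j)}=0. \] \end{enumerate}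
   Context: For a positive integer $m$, $D(m)$ denotes the set of all derangements of $\{1,\dots,m\}$, i.e. permutations $\tau$ of $\{1,\dots,m\}$ with $\tau(j)\neq j$ for all $j$; $\operatorname{sign}(\tau)$ is the sign of the permutation $\tau$. -}

module Defs where

open import Level using (Level; _⊔_) renaming (suc to lsuc)
open import Algebra.Bundles using (CommutativeRing)
open import Data.Nat as ℕ using (ℕ; zero; suc)
open import Data.Integer as ℤ using (ℤ; +_; -[1+_])
open import Data.Fin as Fin using (Fin; toℕ; _≟_)
open import Data.Bool using (Bool; true; false; if_then_else_; _∧_; _∨_; not)
open import Data.List as List using (List; []; _∷_; allFin; concatMap; map; filterᵇ; foldr; length)
open import Data.Vec.Functional using () renaming (_∷_ to _∷ᶠ_)
open import Data.Sign as Sign using (Sign)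
open import Relation.Nullary using (¬_; Dec; yes; no)
open import Relation.Nullary.Decidable using (⌊_⌋)
open import Data.Product using (∃; _×_; _,_)
open import Relation.Binary.PropositionalEquality using (_≡_)

module _ {c ℓ} (R : CommutativeRing c ℓ) where
  open CommutativeRing R
  fromℕ : ℕ → Carrier
  fromℕ zero    = 0#
  fromℕ (suc n) = 1# + fromℕ n

  -- monic polynomial with lower coefficients c₀,…,c_{d-1}, evaluated by Horner:
  -- c₀ + r (c₁ + r (… + r · 1))
  evalMonic : List Carrier → Carrier → Carrier
  evalMonic []       r = 1#
  evalMonic (a ∷ as) r = a + r * evalMonic as r


-- An algebraically closed field of characteristic zero (the first-order
-- theory of the complex numbers).
record ACField (c ℓ : Level) : Set (lsuc (c ⊔ ℓ)) where
  field
    commRing : CommutativeRing c ℓ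
  open CommutativeRing commRing public
  field
    inv         : Carrier → Carrier
    inv-correct : ∀ x → ¬ (x ≈ 0#) → x * inv x ≈ 1#
    0≉1         : ¬ (0# ≈ 1#)

  field
    char0        : ∀ n → ¬ (fromℕ commRing (suc n) ≈ 0#)
    algClosed    : ∀ (a : Carrier) (as : List Carrier) → ∃ λ r → evalMonic commRing (a ∷ as) r ≈ 0#

module _ {c ℓ} (F : ACField c ℓ) where
  open ACField F

  pow : Carrier → ℕ → Carrier
  pow x zero    = 1#
  pow x (suc n) = x * pow x n

  powℤ : Carrier → ℤ → Carrier
  powℤ x (+ n)    = pow x n
  powℤ x -[1+ n ] = pow (inv x) (suc n)

  -- the matrix A of the statement (indices 0-based; only differences matter)
  -- a_ij = (1 - δ_ij) (1 - 1/(1 - x^(i-j)))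
  matA : ∀ {n} → Carrier → Fin n → Fin n → Carrier
  matA x i j with i ≟ j
  ... | yes _ = 0#
  ... | no  _ = 1# - inv (1# - powℤ x (toℕ i ℤ.⊖ toℕ j))

  sumL : List Carrier → Carrier
  sumL = foldr _+_ 0#

  prodL : List Carrier → Carrier
  prodL = foldr _*_ 1#

allFunctions : ∀ m n → List (Fin m → Fin n)
allFunctions zero    n = (λ ()) ∷ []
allFunctions (suc m) n = concatMap (λ f → map (λ a → a ∷ᶠ f) (allFin n)) (allFunctions m n)

allᵇ : ∀ {a} {A : Set a} → (A → Bool) → List A → Bool
allᵇ p = foldr (λ x b → p x ∧ b) true

eqᵇ : ∀ {m} → Fin m → Fin m → Bool
eqᵇ i j = ⌊ i ≟ j ⌋

pairs : ∀ m → List (Fin m × Fin m)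
pairs m = concatMap (λ i → map (λ j → (i , j)) (allFin m)) (allFin m)

isPermᵇ : ∀ {m} → (Fin m → Fin m) → Bool
isPermᵇ {m} τ = allᵇ (λ { (i , j) → eqᵇ i j ∨ not (eqᵇ (τ i) (τ j)) }) (pairs m)

fixedPointFreeᵇ : ∀ {m} → (Fin m → Fin m) → Bool
fixedPointFreeᵇ {m} τ = allᵇ (λ j → not (eqᵇ (τ j) j)) (allFin m)

-- D(m): the derangements of Fin m (as a list without repetitions)
derangements : ∀ m → List (Fin m → Fin m)
derangements m = filterᵇ (λ τ → isPermᵇ τ ∧ fixedPointFreeᵇ τ) (allFunctions m m)

signPow : ℕ → Sign
signPow zero    = Sign.+
signPow (suc k) = Sign.- Sign.* signPow k

inversions : ∀ {m} → (Fin m → Fin m) → ℕ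
inversions {m} τ = length (filterᵇ (λ { (i , j) → (toℕ i ℕ.<ᵇ toℕ j) ∧ (toℕ (τ j) ℕ.<ᵇ toℕ (τ i)) }) (pairs m))

sign : ∀ {m} → (Fin m → Fin m) → Sign
sign τ = signPow (inversions τ)

module _ {c ℓ} (F : ACField c ℓ) where
  open ACField F

  derangementSum : ∀ {m} → (Fin m → Fin m → Carrier) → Sign → Carrier
  derangementSum {m} b σ =
    sumL F (map (λ τ → prodL F (map (λ j → b j (τ j)) (allFin m)))
                (filterᵇ (λ τ → ⌊ sign τ Sign.≟ σ ⌋) (derangements m)))

eqF : ∀ {c ℓ} (F : ACField c ℓ) → ACField.Carrier F → ACField.Carrier F → Set ℓ
eqF F x y = ACField._≈_ F x y
syntax eqF F x y = x ≈[ F ] y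

{-# OPTIONS --safe #-}
-- With y i = x ^ i the off-diagonal entries are b i j = y i / (y i - y j), so for distinct i, j, k
--   b i k * b k j = b i j * (b k j - b k i).
-- Insert the index 0 into an arc j → τ j of a derangement τ of the other indices: the factor
-- b j (τ j) gets replaced by b j 0 * b 0 (τ j), i.e. the weight of τ gets multiplied by
-- b 0 (τ j) - b 0 j, and these multipliers add up to 0 over all arcs of τ.  All insertions flip
-- the sign of τ, so they cancel within each signed sum, and only the permutations that contain a
-- 2-cycle (0 j) remain.  Hence the sum over sign σ reduces to sums over sign - σ on two fewer
-- indices, and descends to the empty permutation (sign +) or to a single index (no derangement).
-- In terms of cofactors the cancellation reads Σᵢⱼ (u j - u i) * b i j * cofactor i j = 0, which
-- holds because expanding along row i and along column j gives the same value for all i and j.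
module Submission where

open import Defs
open import Algebra.Bundles using (CommutativeRing; CommutativeSemiring)
import Algebra.Properties.CommutativeSemigroup as CommutativeSemigroupProperties
import Algebra.Properties.Ring as RingProperties
import Algebra.Properties.Semiring.Sum as SemiringSum
import Algebra.Solver.CommutativeMonoid as CommutativeMonoidSolver
import Algebra.Solver.Ring.NaturalCoefficients.Default as SemiringSolver
open import Data.Bool using (Bool; true; false; if_then_else_; _∧_; _∨_; not)
open import Data.Bool.Properties using (¬-not)
open import Data.Fin as Fin using (Fin; zero; suc; toℕ; punchIn; punchOut; pinch)
open import Data.Fin.Properties as Fin using
  (0≢1+n; punchIn-punchOut; punchOut-injective; punchInᵢ≢i; punchIn-injective; suc-injective; toℕ<n)
import Data.Integer as ℤ
import Data.Integer.Properties as ℤ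
open import Data.List using (List; []; _∷_; _++_; foldr; map; tabulate; allFin; concatMap; filterᵇ; length)
open import Data.List.Membership.Propositional using (_∈_; lose)
open import Data.List.Membership.Propositional.Properties using (∈-allFin; ∈-map⁺; ∈-concatMap⁺)
open import Data.List.Properties using (map-∘; map-cong; map-tabulate)
open import Data.List.Relation.Unary.Any using (here; there)
open import Data.Nat as ℕ using (ℕ; zero; suc; _≤_; _<_; _∸_; _%_; _/_)
open import Data.Nat.Divisibility using (∣-refl)
open import Data.Nat.DivMod using (+-distrib-/-∣ˡ)
import Data.Nat.Properties as ℕ
open import Data.Product using (_×_; _,_; ∃)
open import Data.Sign as Sign using (Sign) renaming (_*_ to _·_)
open import Data.Sign.Properties using () renaming (*-commutativeMonoid to ·-commutativeMonoid; *-assoc to ·-assoc)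
open import Data.Vec.Functional using () renaming (_∷_ to _∷ᶠ_)
open import Function using (_∘_; id; flip)
open import Function.Definitions using (Injective)
open import Relation.Binary using (tri<; tri≈; tri>)
open import Relation.Binary.PropositionalEquality as ≡ using (_≡_; _≢_; _≗_; refl; cong; cong₂)
import Relation.Binary.Reasoning.Setoid as SetoidReasoning
open import Relation.Nullary using (¬_; yes; no; contradiction)
open import Relation.Nullary.Decidable using (⌊_⌋)

-- Signs and the exchange of two deleted indices.

parity : ∀ {n} → Fin n → Sign
parity i = signPow (toℕ i)

-- The map (b , l) ↦ (punchIn b l , pinch l b) exchanges the components of the ordered pair
-- (b , punchIn b l) of distinct indices.
punchIn-swap : ∀ {m} (b : Fin (suc (suc m))) (l : Fin (suc m)) (k : Fin m) →
  punchIn (punchIn b l) (punchIn (pinch l b) k) ≡ punchIn b (punchIn l k)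
punchIn-swap zero    l       k       = refl
punchIn-swap (suc b) zero    k       = refl
punchIn-swap (suc b) (suc l) zero    = refl
punchIn-swap (suc b) (suc l) (suc k) = cong suc (punchIn-swap b l k)

punchIn-pinch : ∀ {m} (b : Fin (suc m)) (l : Fin m) → punchIn (punchIn b l) (pinch l b) ≡ b
punchIn-pinch zero    (suc l) = refl
punchIn-pinch zero    zero    = refl
punchIn-pinch (suc b) zero    = refl
punchIn-pinch (suc b) (suc l) = cong suc (punchIn-pinch b l)

opposite-involutive : ∀ s → Sign.opposite (Sign.opposite s) ≡ s
opposite-involutive Sign.+ = refl
opposite-involutive Sign.- = refl

·-opposite² : ∀ s t → Sign.opposite s · Sign.opposite t ≡ s · t
·-opposite² Sign.+ Sign.+ = refl
·-opposite² Sign.+ Sign.- = refl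
·-opposite² Sign.- Sign.+ = refl
·-opposite² Sign.- Sign.- = refl

-- When two distinct indices are deleted one after the other, the larger one is counted one place
-- lower exactly if it goes second. Hence the position sums of the two orders differ by one.
parity-swap : ∀ {m} (b : Fin (suc m)) (l : Fin m) →
  parity (pinch l b) · parity (punchIn b l) ≡ Sign.opposite (parity l · parity b)
parity-swap zero    zero    = refl
parity-swap zero    (suc l) with parity l
... | Sign.+ = refl
... | Sign.- = refl
parity-swap (suc b) zero    with parity b
... | Sign.+ = refl
... | Sign.- = refl
parity-swap (suc b) (suc l) = ≡.trans (·-opposite² (parity (pinch l b)) _)
  (≡.trans (parity-swap b l) (cong Sign.opposite (≡.sym (·-opposite² (parity l) _))))

-- The form in which `parity-swap` enters the row expansion: `i` is the parity of a row inside a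
-- minor, and `Sign.opposite i` that of the same row in the full matrix, one place further down.
·-rotate : ∀ i p q p′ q′ σ → p · q ≡ Sign.opposite (p′ · q′) →
  i · (p · (q · σ)) ≡ p′ · (Sign.opposite i · (q′ · σ))
·-rotate i p q p′ q′ σ e = begin
  i · (p · (q · σ))                   ≡⟨ cong (i ·_) (·-assoc p q σ) ⟨
  i · (p · q · σ)                     ≡⟨ cong (λ s → i · (s · σ)) e ⟩
  i · (Sign.- · (p′ · q′) · σ)        ≡⟨ solve 5 (λ i e p q s →
    (i ⊕ ((e ⊕ (p ⊕ q)) ⊕ s)) ⊜ (p ⊕ ((e ⊕ i) ⊕ (q ⊕ s)))) refl i Sign.- p′ q′ σ ⟩
  p′ · (Sign.- · i · (q′ · σ)) ∎
  where
  open ≡.≡-Reasoning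
  open CommutativeMonoidSolver ·-commutativeMonoid

opposite-swap : ∀ s t σ → s · (Sign.opposite t · σ) ≡ t · (Sign.opposite s · σ)
opposite-swap s t σ = solve 4 (λ s t e σ → (s ⊕ ((e ⊕ t) ⊕ σ)) ⊜ (t ⊕ ((e ⊕ s) ⊕ σ))) refl s t Sign.- σ
  where open CommutativeMonoidSolver ·-commutativeMonoid

-- `Sign.opposite t` occurs as the parity of a `suc` index; handing the flip to `σ` leaves a genuine
-- cofactor sign for the opposite sign class.
opposite-inward : ∀ s t σ → s · (Sign.opposite t · σ) ≡ s · (t · Sign.opposite σ)
opposite-inward s t σ = solve 4 (λ s t e σ → (s ⊕ ((e ⊕ t) ⊕ σ)) ⊜ (s ⊕ (t ⊕ (e ⊕ σ)))) refl s t Sign.- σ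
  where open CommutativeMonoidSolver ·-commutativeMonoid

-- Finite sums over a commutative semiring, used both in the field and for counting in ℕ.

module Summation {c ℓ} (R : CommutativeSemiring c ℓ) where
  open CommutativeSemiring R hiding (zero) renaming (refl to ≈-refl)
  open CommutativeSemigroupProperties +-commutativeSemigroup using () renaming (x∙yz≈y∙xz to +-swap)
  open SetoidReasoning setoid

  private module S = SemiringSum semiring

  infixr 5 ∑
  -- Opaque because unification would otherwise unfold a sum whose length is a successor.
  opaque
    ∑ : ∀ {n} → (Fin n → Carrier) → Carrier
    ∑ = S.sum

    ∑-zero : ∀ (f : Fin 0 → Carrier) → ∑ f ≈ 0#
    ∑-zero f = ≈-refl

    ∑-suc : ∀ {n} (f : Fin (suc n) → Carrier) → ∑ f ≈ f zero + ∑ (f ∘ suc)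
    ∑-suc f = ≈-refl

    ∑-cong : ∀ {n} {f g : Fin n → Carrier} → (∀ i → f i ≈ g i) → ∑ f ≈ ∑ g
    ∑-cong = S.sum-cong-≋

    ∑-distrib-+ : ∀ {n} (f g : Fin n → Carrier) → ∑ (λ i → f i + g i) ≈ ∑ f + ∑ g
    ∑-distrib-+ = S.∑-distrib-+

    ∑-comm : ∀ {m n} (f : Fin m → Fin n → Carrier) →
      ∑ (λ i → ∑ (λ j → f i j)) ≈ ∑ (λ j → ∑ (λ i → f i j))
    ∑-comm = S.∑-comm

    ∑-punchIn : ∀ {n} i (f : Fin (suc n) → Carrier) → ∑ f ≈ f i + ∑ (f ∘ punchIn i)
    ∑-punchIn i = S.sum-remove {i = i}

    *-distribˡ-∑ : ∀ {n} x (f : Fin n → Carrier) → x * ∑ f ≈ ∑ (λ i → x * f i)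
    *-distribˡ-∑ = S.*-distribˡ-sum

  syntax ∑ (λ i → e) = ∑[ i ] e

  ∑-distrib-* : ∀ {m n} (f : Fin m → Carrier) (g : Fin m → Fin n → Carrier) →
    (∑[ i ] f i * (∑[ j ] g i j)) ≈ (∑[ i ] ∑[ j ] f i * g i j)
  ∑-distrib-* f g = ∑-cong λ i → *-distribˡ-∑ (f i) (g i)

  ∑-suc-suc : ∀ {m n} (f : Fin (suc m) → Fin (suc n) → Carrier) →
    (∑[ i ] ∑[ j ] f i j) ≈
      (∑[ j ] f zero j) + ((∑[ i ] f (suc i) zero) + (∑[ i ] ∑[ j ] f (suc i) (suc j)))
  ∑-suc-suc f = trans (∑-suc _) (+-congˡ (trans (∑-cong λ i → ∑-suc (f (suc i)))
    (∑-distrib-+ _ _)))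

  -- Reindexing by the exchange of components of an ordered pair of distinct indices. Pairs with
  -- first component zero (`A`) and pairs with second component zero (`B`) change places; the pairs
  -- without zero are handled by induction.
  ∑-ordered-pairs-swap : ∀ {m} (G : Fin (suc m) → Fin m → Carrier) →
    (∑[ a ] ∑[ l ] G a l) ≈ (∑[ b ] ∑[ l ] G (punchIn b l) (pinch l b))
  ∑-ordered-pairs-swap {zero}  G = ∑-cong λ a → trans (∑-zero _) (sym (∑-zero _))
  ∑-ordered-pairs-swap {suc m} G = begin
    (∑[ a ] ∑[ l ] G a l)
      ≈⟨ ∑-suc-suc G ⟩
    A + (B + (∑[ a ] ∑[ l ] G (suc a) (suc l)))
      ≈⟨ +-congˡ (+-congˡ (∑-ordered-pairs-swap (λ a l → G (suc a) (suc l)))) ⟩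
    A + (B + C)
      ≈⟨ +-swap A B C ⟩
    B + (A + C)
      ≈⟨ ∑-suc-suc (λ b l → G (punchIn b l) (pinch l b)) ⟨
    (∑[ b ] ∑[ l ] G (punchIn b l) (pinch l b)) ∎
    where
    A = ∑[ l ] G zero l
    B = ∑[ a ] G (suc a) zero
    C = ∑[ b ] ∑[ l ] G (suc (punchIn b l)) (suc (pinch l b))

  ∑-distribʳ-* : ∀ {n} (f : Fin n → Carrier) x → (∑[ i ] f i * x) ≈ ∑ f * x
  ∑-distribʳ-* f x = trans (∑-cong λ i → *-comm (f i) x)
    (trans (sym (*-distribˡ-∑ x f)) (*-comm x _))

  ∑-split-at : ∀ {n} (i : Fin n) {f g : Fin n → Carrier} →
    (∀ j → j ≢ i → f j ≈ g j) → g i ≈ 0# → ∑ f ≈ f i + ∑ g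
  ∑-split-at {suc n} i {f} {g} f≈g gᵢ≈0 = begin
    ∑ f                              ≈⟨ ∑-punchIn i f ⟩
    f i + ∑ (f ∘ punchIn i)          ≈⟨ +-congˡ (∑-cong λ j → f≈g (punchIn i j) (punchInᵢ≢i i j)) ⟩
    f i + ∑ (g ∘ punchIn i)          ≈⟨ +-congˡ (+-identityˡ _) ⟨
    f i + (0# + ∑ (g ∘ punchIn i))   ≈⟨ +-congˡ (+-congʳ gᵢ≈0) ⟨
    f i + (g i + ∑ (g ∘ punchIn i))  ≈⟨ +-congˡ (∑-punchIn i g) ⟨
    f i + ∑ g                        ∎

  ∑-vanish : ∀ {n} {f : Fin n → Carrier} → (∀ i → f i ≈ 0#) → ∑ f ≈ 0#
  ∑-vanish {zero}  f≈0 = ∑-zero _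
  ∑-vanish {suc n} f≈0 = trans (∑-suc _)
    (trans (+-cong (f≈0 zero) (∑-vanish (f≈0 ∘ suc))) (+-identityˡ 0#))

  ∑-allFin : ∀ {n} (f : Fin n → Carrier) → foldr _+_ 0# (map f (allFin n)) ≈ ∑ f
  ∑-allFin = ∑-tabulate id
    where
    ∑-tabulate : ∀ {n} {a} {A : Set a} (g : Fin n → A) (f : A → Carrier) →
      foldr _+_ 0# (map f (tabulate g)) ≈ ∑ (f ∘ g)
    ∑-tabulate {zero}  g f = sym (∑-zero _)
    ∑-tabulate {suc n} g f = trans (+-congˡ (∑-tabulate (g ∘ suc) f)) (sym (∑-suc _))

  module _ {a} {A : Set a} where

    ∑ˡ : List A → (A → Carrier) → Carrier
    ∑ˡ xs f = foldr _+_ 0# (map f xs)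

    ∑ˡ-cong : ∀ xs {f g : A → Carrier} → (∀ x → f x ≈ g x) → ∑ˡ xs f ≈ ∑ˡ xs g
    ∑ˡ-cong []       f≈g = ≈-refl
    ∑ˡ-cong (x ∷ xs) f≈g = +-cong (f≈g x) (∑ˡ-cong xs f≈g)

    ∑ˡ-vanish : ∀ xs {f : A → Carrier} → (∀ x → f x ≈ 0#) → ∑ˡ xs f ≈ 0#
    ∑ˡ-vanish []       f≈0 = ≈-refl
    ∑ˡ-vanish (x ∷ xs) f≈0 = trans (+-cong (f≈0 x) (∑ˡ-vanish xs f≈0)) (+-identityˡ 0#)

    ∑ˡ-++ : ∀ xs ys (f : A → Carrier) → ∑ˡ (xs ++ ys) f ≈ ∑ˡ xs f + ∑ˡ ys f
    ∑ˡ-++ []       ys f = sym (+-identityˡ _)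
    ∑ˡ-++ (x ∷ xs) ys f = trans (+-congˡ (∑ˡ-++ xs ys f)) (sym (+-assoc _ _ _))

    ∑ˡ-filterᵇ : ∀ (p : A → Bool) xs (f : A → Carrier) →
      ∑ˡ (filterᵇ p xs) f ≈ ∑ˡ xs (λ x → if p x then f x else 0#)
    ∑ˡ-filterᵇ p []       f = ≈-refl
    ∑ˡ-filterᵇ p (x ∷ xs) f with p x
    ... | true  = +-congˡ (∑ˡ-filterᵇ p xs f)
    ... | false = trans (∑ˡ-filterᵇ p xs f) (sym (+-identityˡ _))

    *-distribˡ-∑ˡ : ∀ x ys (f : A → Carrier) → ∑ˡ ys (λ y → x * f y) ≈ x * ∑ˡ ys f
    *-distribˡ-∑ˡ x []       f = sym (zeroʳ x)
    *-distribˡ-∑ˡ x (y ∷ ys) f = trans (+-congˡ (*-distribˡ-∑ˡ x ys f)) (sym (distribˡ x _ _))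

    ∑ˡ-∑-comm : ∀ {n} xs (f : A → Fin n → Carrier) →
      ∑ˡ xs (λ x → ∑ (f x)) ≈ (∑[ i ] ∑ˡ xs (λ x → f x i))
    ∑ˡ-∑-comm []       f = sym (∑-vanish λ _ → ≈-refl)
    ∑ˡ-∑-comm (x ∷ xs) f = trans (+-congˡ (∑ˡ-∑-comm xs f)) (sym (∑-distrib-+ (f x) _))

  ∑ˡ-concatMap : ∀ {a b} {A : Set a} {B : Set b} (g : A → List B) xs (f : B → Carrier) →
    ∑ˡ (concatMap g xs) f ≈ ∑ˡ xs (λ x → ∑ˡ (g x) f)
  ∑ˡ-concatMap g []       f = ≈-refl
  ∑ˡ-concatMap g (x ∷ xs) f = trans (∑ˡ-++ (g x) _ f) (+-congˡ (∑ˡ-concatMap g xs f))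

  ∑ˡ-map : ∀ {a b} {A : Set a} {B : Set b} (g : A → B) xs (f : B → Carrier) →
    ∑ˡ (map g xs) f ≈ ∑ˡ xs (f ∘ g)
  ∑ˡ-map g xs f = reflexive (cong (foldr _+_ 0#) (≡.sym (map-∘ xs)))

  ∑-pairs : ∀ m (f : Fin m × Fin m → Carrier) → ∑ˡ (pairs m) f ≈ (∑[ i ] ∑[ j ] f (i , j))
  ∑-pairs m f = begin
    ∑ˡ (pairs m) f
      ≈⟨ ∑ˡ-concatMap (λ i → map (i ,_) (allFin m)) (allFin m) f ⟩
    ∑ˡ (allFin m) (λ i → ∑ˡ (map (i ,_) (allFin m)) f)
      ≈⟨ ∑ˡ-cong (allFin m) (λ i → trans (∑ˡ-map (i ,_) (allFin m) f) (∑-allFin _)) ⟩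
    ∑ˡ (allFin m) (λ i → ∑[ j ] f (i , j))
      ≈⟨ ∑-allFin _ ⟩
    (∑[ i ] ∑[ j ] f (i , j)) ∎

  ∑-allFunctions : ∀ m n (h : (Fin (suc m) → Fin n) → Carrier) →
    ∑ˡ (allFunctions (suc m) n) h ≈ (∑[ a ] ∑ˡ (allFunctions m n) (λ f → h (a ∷ᶠ f)))
  ∑-allFunctions m n h = begin
    ∑ˡ (allFunctions (suc m) n) h
      ≈⟨ ∑ˡ-concatMap (λ f → map (_∷ᶠ f) (allFin n)) (allFunctions m n) h ⟩
    ∑ˡ (allFunctions m n) (λ f → ∑ˡ (map (_∷ᶠ f) (allFin n)) h)
      ≈⟨ ∑ˡ-cong (allFunctions m n) (λ f → trans (∑ˡ-map (_∷ᶠ f) (allFin n) h) (∑-allFin _)) ⟩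
    ∑ˡ (allFunctions m n) (λ f → ∑[ a ] h (a ∷ᶠ f))
      ≈⟨ ∑ˡ-∑-comm (allFunctions m n) (λ f a → h (a ∷ᶠ f)) ⟩
    (∑[ a ] ∑ˡ (allFunctions m n) (λ f → h (a ∷ᶠ f))) ∎

  -- A function that avoids the value `a` factors uniquely through `punchIn a`, and all others
  -- contribute zero. `h` must respect pointwise equality because the two ways of building such a
  -- function agree only pointwise.
  ∑-allFunctions-punchIn : ∀ m {n} (a : Fin (suc n)) (h : (Fin m → Fin (suc n)) → Carrier) →
    (∀ {f g} → f ≗ g → h f ≈ h g) → (∀ f j → f j ≡ a → h f ≈ 0#) →
    ∑ˡ (allFunctions m (suc n)) h ≈ ∑ˡ (allFunctions m n) (λ g → h (punchIn a ∘ g))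
  ∑-allFunctions-punchIn zero    a h h-cong h-avoid = +-congʳ (h-cong λ ())
  ∑-allFunctions-punchIn (suc m) {n} a h h-cong h-avoid = begin
    ∑ˡ (allFunctions (suc m) (suc n)) h
      ≈⟨ ∑-allFunctions m (suc n) h ⟩
    (∑[ a′ ] ∑ˡ (allFunctions m (suc n)) (λ f → h (a′ ∷ᶠ f)))
      ≈⟨ ∑-punchIn a _ ⟩
    ∑ˡ (allFunctions m (suc n)) (λ f → h (a ∷ᶠ f)) +
      (∑[ l ] ∑ˡ (allFunctions m (suc n)) (λ f → h (punchIn a l ∷ᶠ f)))
      ≈⟨ +-congʳ (∑ˡ-vanish (allFunctions m (suc n)) λ f → h-avoid (a ∷ᶠ f) zero refl) ⟩
    0# + (∑[ l ] ∑ˡ (allFunctions m (suc n)) (λ f → h (punchIn a l ∷ᶠ f)))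
      ≈⟨ +-identityˡ _ ⟩
    (∑[ l ] ∑ˡ (allFunctions m (suc n)) (λ f → h (punchIn a l ∷ᶠ f)))
      ≈⟨ ∑-cong (λ l → ∑-allFunctions-punchIn m a (λ f → h (punchIn a l ∷ᶠ f))
           (λ f≗g → h-cong λ { zero → refl ; (suc i) → f≗g i })
           (λ f j fj≡a → h-avoid (punchIn a l ∷ᶠ f) (suc j) fj≡a)) ⟩
    (∑[ l ] ∑ˡ (allFunctions m n) (λ g → h (punchIn a l ∷ᶠ (punchIn a ∘ g))))
      ≈⟨ ∑-cong (λ l → ∑ˡ-cong (allFunctions m n) λ g → h-cong λ { zero → refl ; (suc i) → refl }) ⟩
    (∑[ l ] ∑ˡ (allFunctions m n) (λ g → h (punchIn a ∘ (l ∷ᶠ g))))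
      ≈⟨ ∑-allFunctions m n (λ g → h (punchIn a ∘ g)) ⟨
    ∑ˡ (allFunctions (suc m) n) (λ g → h (punchIn a ∘ g)) ∎

  -- An injective self-map of a finite set is a bijection: after `g zero` is taken out of the
  -- target, `punchOut` turns the rest of `g` into a smaller injective self-map.
  ∑-∘-injective : ∀ {n} (g : Fin n → Fin n) → Injective _≡_ _≡_ g →
    ∀ (h : Fin n → Carrier) → ∑ (h ∘ g) ≈ ∑ h
  ∑-∘-injective {zero}  g inj h = ∑-cong λ ()
  ∑-∘-injective {suc n} g inj h = begin
    ∑ (h ∘ g)
      ≈⟨ ∑-suc _ ⟩
    h (g zero) + ∑ (h ∘ g ∘ suc)
      ≈⟨ +-congˡ (∑-cong λ i → reflexive (cong h (≡.sym (punchIn-punchOut (g₀≢ i))))) ⟩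
    h (g zero) + ∑ (h ∘ punchIn (g zero) ∘ g′)
      ≈⟨ +-congˡ (∑-∘-injective g′ g′-injective (h ∘ punchIn (g zero))) ⟩
    h (g zero) + ∑ (h ∘ punchIn (g zero))
      ≈⟨ ∑-punchIn (g zero) h ⟨
    ∑ h ∎
    where
    g₀≢ : ∀ i → g zero ≢ g (suc i)
    g₀≢ i eq = 0≢1+n (inj eq)
    g′ : Fin n → Fin n
    g′ i = punchOut (g₀≢ i)
    g′-injective : Injective _≡_ _≡_ g′
    g′-injective {i} {j} eq = suc-injective (inj (punchOut-injective (g₀≢ i) (g₀≢ j) eq))

-- Expansion of the permutation sums of fixed sign along rows and columns.

module Laplace {c ℓ} (R : CommutativeRing c ℓ) where
  open CommutativeRing R hiding (zero) renaming (refl to ≈-refl)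
  open Summation commutativeSemiring
  open CommutativeSemigroupProperties *-commutativeSemigroup using () renaming (x∙yz≈y∙xz to *-swap)
  open RingProperties ring using (+-cancelʳ)
  open SetoidReasoning setoid

  Matrix : ℕ → Set c
  Matrix m = Fin m → Fin m → Carrier

  minor : ∀ {m} → Fin (suc m) → Fin (suc m) → Matrix (suc m) → Matrix m
  minor i j M k l = M (punchIn i k) (punchIn j l)

  -- The sum of the products ∏ M i (τ i) over the permutations τ of sign σ.
  laplace : ∀ {m} → Matrix m → Sign → Carrier
  laplace {zero}  M Sign.+ = 1#
  laplace {zero}  M Sign.- = 0#
  laplace {suc m} M σ = ∑[ a ] M zero a * laplace (minor zero a M) (parity a · σ)

  laplace-cong : ∀ {m} {M N : Matrix m} {σ τ} → (∀ i j → M i j ≈ N i j) → σ ≡ τ →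
    laplace M σ ≈ laplace N τ
  laplace-cong {zero}  {σ = Sign.+} M≈N refl = ≈-refl
  laplace-cong {zero}  {σ = Sign.-} M≈N refl = ≈-refl
  laplace-cong {suc m} {M} {N} M≈N refl = ∑-cong λ a →
    *-cong (M≈N zero a) (laplace-cong {M = minor zero a M} {N = minor zero a N} (λ i j → M≈N _ _) refl)

  -- Expand along row zero and then, by induction, along row `i` of each minor. Exchanging the two
  -- chosen columns makes `b` the column of row `suc i` and `punchIn b l` that of row zero; the sign
  -- change of `parity-swap` is absorbed by the step from `i` to `suc i`.
  laplace-row : ∀ {m} (i : Fin (suc m)) (M : Matrix (suc m)) σ →
    laplace M σ ≈ (∑[ b ] M i b * laplace (minor i b M) (parity i · (parity b · σ)))
  laplace-row zero M σ = ≈-refl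
  laplace-row {suc m} (suc i) M σ = begin
    (∑[ a ] M zero a * laplace (minor zero a M) (parity a · σ))
      ≈⟨ ∑-cong (λ a → *-congˡ (laplace-row i (minor zero a M) (parity a · σ))) ⟩
    (∑[ a ] M zero a * (∑[ l ] M (suc i) (punchIn a l) * N a l))
      ≈⟨ ∑-distrib-* (M zero) (λ a l → M (suc i) (punchIn a l) * N a l) ⟩
    (∑[ a ] ∑[ l ] M zero a * (M (suc i) (punchIn a l) * N a l))
      ≈⟨ ∑-ordered-pairs-swap (λ a l → M zero a * (M (suc i) (punchIn a l) * N a l)) ⟩
    (∑[ b ] ∑[ l ]
      M zero (punchIn b l) * (M (suc i) (punchIn (punchIn b l) (pinch l b)) * N (punchIn b l) (pinch l b)))
      ≈⟨ ∑-cong (λ b → ∑-cong (term b)) ⟩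
    (∑[ b ] ∑[ l ] M (suc i) b * (M zero (punchIn b l) * N′ b l))
      ≈⟨ sym (∑-distrib-* (M (suc i)) (λ b l → M zero (punchIn b l) * N′ b l)) ⟩
    (∑[ b ] M (suc i) b * laplace (minor (suc i) b M) (parity (suc i) · (parity b · σ))) ∎
    where
    N N′ : Fin (suc (suc m)) → Fin (suc m) → Carrier
    N a l = laplace (minor i l (minor zero a M)) (parity i · (parity l · (parity a · σ)))
    N′ b l = laplace (minor zero l (minor (suc i) b M)) (parity l · (parity (suc i) · (parity b · σ)))
    term : ∀ b l →
      M zero (punchIn b l) * (M (suc i) (punchIn (punchIn b l) (pinch l b)) * N (punchIn b l) (pinch l b))
      ≈ M (suc i) b * (M zero (punchIn b l) * N′ b l)
    term b l = trans (*-swap _ _ _) (*-cong (reflexive (cong (M (suc i)) (punchIn-pinch b l)))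
      (*-congˡ (laplace-cong
        (λ k k′ → reflexive (cong (M _) (punchIn-swap b l k′)))
        (·-rotate (parity i) (parity (pinch l b)) _ (parity l) (parity b) σ (parity-swap b l)))))

  -- Either the index 0 is fixed, or it sits between some `suc i` and some `suc j`. This form is
  -- symmetric in rows and columns up to the order of summation, so expansion along column zero can
  -- be read off from it; the two lemmas are mutually recursive, the border expansion calling the
  -- column expansion one size smaller.
  laplace-border : ∀ {m} (M : Matrix (suc (suc m))) σ →
    laplace M σ ≈ M zero zero * laplace (minor zero zero M) σ +
      (∑[ j ] ∑[ i ] M zero (suc j) * (M (suc i) zero *
        laplace (minor i j (minor zero zero M)) (parity i · (parity (suc j) · σ))))
  laplace-column₀ : ∀ {m} (M : Matrix (suc m)) σ →
    laplace M σ ≈ (∑[ i ] M i zero * laplace (minor i zero M) (parity i · σ))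

  laplace-border {m} M σ = trans (∑-suc _) (+-congˡ (trans
    (∑-cong λ j → *-congˡ (laplace-column₀ (minor zero (suc j) M) (parity (suc j) · σ)))
    (∑-distrib-* (λ j → M zero (suc j)) (λ j i → M (suc i) zero *
        laplace (minor i j (minor zero zero M)) (parity i · (parity (suc j) · σ))))))

  laplace-column₀ {zero}  M σ = ∑-cong λ { zero → ≈-refl }
  laplace-column₀ {suc m} M σ = trans (laplace-border M σ) (trans (+-congˡ (begin
    ∑[ j ] ∑[ i ] M zero (suc j) * (M (suc i) zero * N i j)
      ≈⟨ ∑-comm (λ j i → M zero (suc j) * (M (suc i) zero * N i j)) ⟩
    ∑[ i ] ∑[ j ] M zero (suc j) * (M (suc i) zero * N i j)
      ≈⟨ ∑-cong (λ i → ∑-cong λ j → trans (*-swap _ _ _)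
           (*-congˡ (*-congˡ (reflexive (cong (laplace (minor i j (minor zero zero M)))
             (opposite-swap (parity i) (parity j) σ)))))) ⟩
    (∑[ i ] ∑[ j ] M (suc i) zero * (M zero (suc j) * N′ i j))
      ≈⟨ sym (∑-distrib-* (λ i → M (suc i) zero) (λ i j → M zero (suc j) * N′ i j)) ⟩
    (∑[ i ] M (suc i) zero * laplace (minor (suc i) zero M) (parity (suc i) · σ)) ∎)) (sym (∑-suc _)))
    where
    N N′ : Fin (suc m) → Fin (suc m) → Carrier
    N i j = laplace (minor i j (minor zero zero M)) (parity i · (parity (suc j) · σ))
    N′ i j = laplace (minor i j (minor zero zero M)) (parity j · (parity (suc i) · σ))

  laplace-flip : ∀ {m} (M : Matrix m) σ → laplace (flip M) σ ≈ laplace M σ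
  laplace-flip {zero}  M Sign.+ = ≈-refl
  laplace-flip {zero}  M Sign.- = ≈-refl
  laplace-flip {suc m} M σ = trans
    (∑-cong λ a → *-congˡ (laplace-flip (minor a zero M) (parity a · σ)))
    (sym (laplace-column₀ M σ))

  laplace-column : ∀ {m} (j : Fin (suc m)) (M : Matrix (suc m)) σ →
    laplace M σ ≈ (∑[ i ] M i j * laplace (minor i j M) (parity j · (parity i · σ)))
  laplace-column j M σ = trans (sym (laplace-flip M σ)) (trans (laplace-row j (flip M) σ)
    (∑-cong λ i → *-congˡ (laplace-flip (minor i j M) _)))

  -- Vanishing for matrices with the three-term relation.

  record ThreeTerm {m} (b : Matrix m) : Set ℓ where
    field
      diagonal : ∀ i → b i i ≈ 0#
      -- b i k * b k j = b i j * (b k j - b k i), moved so that no subtraction occurs.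
      exchange : ∀ {i j k} → i ≢ j → j ≢ k → i ≢ k →
        b i k * b k j + b k i * b i j ≈ b k j * b i j

  open ThreeTerm

  -- Serves twice: for the passage to the submatrix of kept indices, and for the removal of a
  -- 2-cycle in the recursion.
  ThreeTerm-restrict : ∀ {m n} {b : Matrix m} (f : Fin n → Fin m) →
    Injective _≡_ _≡_ f → ThreeTerm b → ThreeTerm (λ i j → b (f i) (f j))
  ThreeTerm-restrict f inj h .diagonal i = h .diagonal (f i)
  ThreeTerm-restrict f inj h .exchange i≢j j≢k i≢k =
    h .exchange (i≢j ∘ inj) (j≢k ∘ inj) (i≢k ∘ inj)

  -- `T` collects the border terms. Off the diagonal the exchange relation reads
  -- `T j i + V j i ≈ U j i`, and `U` and `V` have equal totals, so the terms with `i` different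
  -- from `j` cancel and only the 2-cycles of 0 with `suc j` remain.
  laplace-remove-pair : ∀ {m} {b : Matrix (suc (suc m))} → ThreeTerm b → ∀ σ →
    laplace b σ ≈ (∑[ j ] b zero (suc j) * (b (suc j) zero *
      laplace (minor j j (minor zero zero b)) (parity j · (parity (suc j) · σ))))
  laplace-remove-pair {m} {b} h σ = begin
    laplace b σ
      ≈⟨ laplace-border b σ ⟩
    b zero zero * laplace b′ σ + (∑[ j ] ∑[ i ] T j i)
      ≈⟨ +-congʳ (trans (*-congʳ (h .diagonal zero)) (zeroˡ _)) ⟩
    0# + (∑[ j ] ∑[ i ] T j i)
      ≈⟨ +-identityˡ _ ⟩
    (∑[ j ] ∑[ i ] T j i)
      -- The total of `V` is added on both sides and cancelled, in place of a subtraction.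
      ≈⟨ +-cancelʳ (∑[ j ] ∑[ i ] V j i) _ _ T+V ⟩
    (∑[ j ] T j j) ∎
    where
    b′ = minor zero zero b
    L T U V : Fin (suc m) → Fin (suc m) → Carrier
    -- Since `parity (suc j)` is the opposite of `parity j`, this is the cofactor of the entry
    -- `b′ i j` for the sign `Sign.opposite σ`; hence the sign in `X`.
    L j i = laplace (minor i j b′) (parity i · (parity (suc j) · σ))
    T j i = b zero (suc j) * (b (suc i) zero * L j i)
    U j i = b zero (suc j) * (b′ i j * L j i)
    V j i = b zero (suc i) * (b′ i j * L j i)
    u : Fin (suc m) → Carrier
    u j = b zero (suc j)
    X = laplace b′ (Sign.opposite σ)

    -- For fixed `j` the sum over `i` expands `b′` along column `j`, giving `X` for every `j`. `ΣV`
    -- does the same with rows, after the order of summation is exchanged.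
    ΣU : (∑[ j ] ∑[ i ] U j i) ≈ ∑ u * X
    ΣU = begin
      (∑[ j ] ∑[ i ] U j i)
        ≈⟨ ∑-distrib-* u (λ j i → b′ i j * L j i) ⟨
      (∑[ j ] u j * (∑[ i ] b′ i j * L j i))
        ≈⟨ ∑-cong (λ j → *-congˡ (∑-cong λ i → *-congˡ (reflexive (cong (laplace (minor i j b′))
             (≡.trans (opposite-swap (parity i) (parity j) σ) (opposite-inward (parity j) (parity i) σ)))))) ⟩
      (∑[ j ] u j * (∑[ i ] b′ i j * laplace (minor i j b′) (parity j · (parity i · Sign.opposite σ))))
        ≈⟨ ∑-cong (λ j → *-congˡ (laplace-column j b′ (Sign.opposite σ))) ⟨
      (∑[ j ] u j * X)
        ≈⟨ ∑-distribʳ-* u X ⟩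
      ∑ u * X ∎

    ΣV : (∑[ j ] ∑[ i ] V j i) ≈ ∑ u * X
    ΣV = begin
      (∑[ j ] ∑[ i ] V j i)
        ≈⟨ ∑-comm V ⟩
      (∑[ i ] ∑[ j ] V j i)
        ≈⟨ ∑-distrib-* u (λ i j → b′ i j * L j i) ⟨
      (∑[ i ] u i * (∑[ j ] b′ i j * L j i))
        ≈⟨ ∑-cong (λ i → *-congˡ (∑-cong λ j → *-congˡ (reflexive (cong (laplace (minor i j b′))
             (opposite-inward (parity i) (parity j) σ))))) ⟩
      (∑[ i ] u i * (∑[ j ] b′ i j * laplace (minor i j b′) (parity i · (parity j · Sign.opposite σ))))
        ≈⟨ ∑-cong (λ i → *-congˡ (laplace-row i b′ (Sign.opposite σ))) ⟨
      (∑[ i ] u i * X)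
        ≈⟨ ∑-distribʳ-* u X ⟩
      ∑ u * X ∎

    off-diagonal : ∀ j i → i ≢ j → T j i + V j i ≈ U j i
    off-diagonal j i i≢j = begin
      u j * (b (suc i) zero * L j i) + u i * (b′ i j * L j i)
        ≈⟨ +-cong (trans (*-swap _ _ _) (sym (*-assoc _ _ _))) (sym (*-assoc _ _ _)) ⟩
      b (suc i) zero * u j * L j i + u i * b′ i j * L j i
        ≈⟨ distribʳ (L j i) _ _ ⟨
      (b (suc i) zero * u j + u i * b′ i j) * L j i
        ≈⟨ *-congʳ (h .exchange (i≢j ∘ suc-injective) (λ ()) (λ ())) ⟩
      u j * b′ i j * L j i
        ≈⟨ *-assoc _ _ _ ⟩
      u j * (b′ i j * L j i) ∎

    U-diagonal : ∀ j → U j j ≈ 0#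
    U-diagonal j = trans (*-congˡ (trans (*-congʳ (h .diagonal (suc j))) (zeroˡ _))) (zeroʳ _)

    T+V : (∑[ j ] ∑[ i ] T j i) + (∑[ j ] ∑[ i ] V j i) ≈ (∑[ j ] T j j) + (∑[ j ] ∑[ i ] V j i)
    T+V = begin
      (∑[ j ] ∑[ i ] T j i) + (∑[ j ] ∑[ i ] V j i)
        ≈⟨ ∑-distrib-+ _ _ ⟨
      (∑[ j ] (∑[ i ] T j i) + (∑[ i ] V j i))
        ≈⟨ ∑-cong (λ j → ∑-distrib-+ (T j) (V j)) ⟨
      (∑[ j ] ∑[ i ] T j i + V j i)
        ≈⟨ ∑-cong (λ j → ∑-split-at j (off-diagonal j) (U-diagonal j)) ⟩
      (∑[ j ] (T j j + V j j) + (∑[ i ] U j i))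
        -- `V j j` and `U j j` are the same expression, so `U-diagonal` disposes of `V j j`.
        ≈⟨ ∑-cong (λ j → +-congʳ (trans (+-congˡ (U-diagonal j)) (+-identityʳ _))) ⟩
      (∑[ j ] T j j + (∑[ i ] U j i))
        ≈⟨ ∑-distrib-+ _ _ ⟩
      (∑[ j ] T j j) + (∑[ j ] ∑[ i ] U j i)
        ≈⟨ +-congˡ (trans ΣU (sym ΣV)) ⟩
      (∑[ j ] T j j) + (∑[ j ] ∑[ i ] V j i) ∎

  -- The two parities are opposite: removing a 2-cycle flips the sign of a permutation.
  parity-pair : ∀ {m} (j : Fin m) σ → parity j · (parity (suc j) · σ) ≡ Sign.opposite σ
  parity-pair j σ with parity j
  ... | Sign.+ = refl
  ... | Sign.- = refl

  laplace-remove-pair-vanish : ∀ {m} {b : Matrix (suc (suc m))} → ThreeTerm b → ∀ σ →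
    (∀ {b′ : Matrix m} → ThreeTerm b′ → laplace b′ (Sign.opposite σ) ≈ 0#) → laplace b σ ≈ 0#
  laplace-remove-pair-vanish {b = b} h σ vanish = trans (laplace-remove-pair h σ) (∑-vanish λ j →
    trans (*-congˡ (trans (*-congˡ (trans
      (reflexive (cong (laplace (minor j j (minor zero zero b))) (parity-pair j σ)))
      (vanish (ThreeTerm-restrict (suc ∘ punchIn j) (punchIn-injective j _ _ ∘ suc-injective) h))))
      (zeroʳ _))) (zeroʳ _))

  laplace-odd-vanish : ∀ m {b : Matrix m} → ThreeTerm b → m ℕ.% 2 ≡ 1 → ∀ σ → laplace b σ ≈ 0#
  laplace-odd-vanish (suc zero) h _ σ = ∑-vanish λ { zero → trans (*-congʳ (h .diagonal zero)) (zeroˡ _) }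
  laplace-odd-vanish (suc (suc m)) h odd σ = laplace-remove-pair-vanish h σ λ h′ →
    -- `%` computes through two successors, so `odd` serves for `m` as it stands.
    laplace-odd-vanish m h′ odd (Sign.opposite σ)

  laplace-even-vanish : ∀ m {b : Matrix m} → ThreeTerm b → m ℕ.% 2 ≡ 0 →
    laplace b (signPow (m ℕ./ 2 ℕ.+ 1)) ≈ 0#
  -- The sign here is `Sign.-`, while the empty permutation has sign `Sign.+`.
  laplace-even-vanish zero h _ = ≈-refl
  laplace-even-vanish (suc (suc m)) {b} h even =
    -- Unlike `%`, `/` accumulates its result and does not reduce to a successor here; the lemma
    -- supplies the extra 1, whose sign flip cancels against the one from the removed 2-cycle.
    trans (reflexive (cong (λ q → laplace b (signPow (q ℕ.+ 1))) (+-distrib-/-∣ˡ m (∣-refl {2}))))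
    (laplace-remove-pair-vanish h _ λ {b′} h′ →
      trans (reflexive (cong (laplace b′) (opposite-involutive _))) (laplace-even-vanish m h′ even))

-- The Boolean permutation test as injectivity.

allᵇ-lookup : ∀ {a} {A : Set a} (p : A → Bool) {xs x} → allᵇ p xs ≡ true → x ∈ xs → p x ≡ true
allᵇ-lookup p {y ∷ xs} all (here refl) with p y
... | true = refl
allᵇ-lookup p {y ∷ xs} all (there x∈xs) with p y
... | true = allᵇ-lookup p all x∈xs

allᵇ-universal : ∀ {a} {A : Set a} (p : A → Bool) → (∀ x → p x ≡ true) → ∀ xs → allᵇ p xs ≡ true
allᵇ-universal p px []       = refl
allᵇ-universal p px (x ∷ xs) = cong₂ _∧_ (px x) (allᵇ-universal p px xs)

allᵇ-witness : ∀ {a} {A : Set a} (p : A → Bool) xs → allᵇ p xs ≡ false → ∃ λ x → p x ≡ false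
allᵇ-witness p (x ∷ xs) none with p x in px
... | true  = allᵇ-witness p xs none
... | false = x , px

∈-pairs : ∀ {m} (i j : Fin m) → (i , j) ∈ pairs m
∈-pairs {m} i j = ∈-concatMap⁺ (λ i → map (i ,_) (allFin m))
  (lose (∈-allFin i) (∈-map⁺ (i ,_) (∈-allFin j)))

isPermᵇ-sound : ∀ {m} (τ : Fin m → Fin m) → isPermᵇ τ ≡ true → Injective _≡_ _≡_ τ
isPermᵇ-sound τ perm {i} {j} τi≡τj with i Fin.≟ j | τ i Fin.≟ τ j | allᵇ-lookup _ perm (∈-pairs i j)
... | yes i≡j | _        | _  = i≡j
... | no _    | yes _    | ()
... | no _    | no τi≢τj | _  = contradiction τi≡τj τi≢τj

isPermᵇ-complete : ∀ {m} (τ : Fin m → Fin m) → Injective _≡_ _≡_ τ → isPermᵇ τ ≡ true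
isPermᵇ-complete {m} τ inj = allᵇ-universal _ separated (pairs m)
  where
  separated : ((i , j) : Fin m × Fin m) → eqᵇ i j ∨ not (eqᵇ (τ i) (τ j)) ≡ true
  separated (i , j) with i Fin.≟ j | τ i Fin.≟ τ j
  ... | yes _   | _         = refl
  ... | no i≢j  | yes τi≡τj = contradiction (inj τi≡τj) i≢j
  ... | no _    | no _      = refl

isPermᵇ-⇔ : ∀ {m n} (τ : Fin m → Fin m) (ρ : Fin n → Fin n) →
  (Injective _≡_ _≡_ τ → Injective _≡_ _≡_ ρ) → (Injective _≡_ _≡_ ρ → Injective _≡_ _≡_ τ) →
  isPermᵇ τ ≡ isPermᵇ ρ
isPermᵇ-⇔ τ ρ to from with isPermᵇ τ in τ-perm | isPermᵇ ρ in ρ-perm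
... | true  | true  = refl
... | false | false = refl
... | true  | false = ≡.trans (≡.sym (isPermᵇ-complete ρ (to (isPermᵇ-sound τ τ-perm)))) ρ-perm
... | false | true  = ≡.trans (≡.sym τ-perm) (isPermᵇ-complete τ (from (isPermᵇ-sound ρ ρ-perm)))

isPermᵇ-cong : ∀ {m} {τ ρ : Fin m → Fin m} → τ ≗ ρ → isPermᵇ τ ≡ isPermᵇ ρ
isPermᵇ-cong {τ = τ} {ρ} τ≗ρ = isPermᵇ-⇔ τ ρ
  (λ inj e → inj (≡.trans (τ≗ρ _) (≡.trans e (≡.sym (τ≗ρ _)))))
  (λ inj e → inj (≡.trans (≡.sym (τ≗ρ _)) (≡.trans e (τ≗ρ _))))

isPermᵇ-repeat : ∀ {m} (τ : Fin m → Fin m) {i j} → i ≢ j → τ i ≡ τ j → isPermᵇ τ ≡ false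
isPermᵇ-repeat τ i≢j τi≡τj = ¬-not λ perm → i≢j (isPermᵇ-sound τ perm τi≡τj)

-- Values of `punchIn a` differ from `a`, so the new value at zero collides with nothing and
-- injectivity is decided by `g`.
isPermᵇ-∷ : ∀ {m} (a : Fin (suc m)) (g : Fin m → Fin m) → isPermᵇ (a ∷ᶠ (punchIn a ∘ g)) ≡ isPermᵇ g
isPermᵇ-∷ a g = isPermᵇ-⇔ (a ∷ᶠ (punchIn a ∘ g)) g
  (λ inj e → suc-injective (inj (cong (punchIn a) e)))
  (λ inj {i} {j} → extend inj i j)
  where
  extend : Injective _≡_ _≡_ g → ∀ i j → (a ∷ᶠ (punchIn a ∘ g)) i ≡ (a ∷ᶠ (punchIn a ∘ g)) j → i ≡ j
  extend inj zero    zero    e = refl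
  extend inj zero    (suc j) e = contradiction (≡.sym e) (punchInᵢ≢i a (g j))
  extend inj (suc i) zero    e = contradiction e (punchInᵢ≢i a (g i))
  extend inj (suc i) (suc j) e = cong suc (inj (punchIn-injective a _ _ e))

-- Inversions and the sign of an extended permutation.

punchIn-<ᵇ : ∀ {m} (a : Fin (suc m)) (i j : Fin m) →
  (toℕ (punchIn a i) ℕ.<ᵇ toℕ (punchIn a j)) ≡ (toℕ i ℕ.<ᵇ toℕ j)
punchIn-<ᵇ zero    i       j       = refl
punchIn-<ᵇ (suc a) zero    zero    = refl
punchIn-<ᵇ (suc a) zero    (suc j) = refl
punchIn-<ᵇ (suc a) (suc i) zero    = refl
punchIn-<ᵇ (suc a) (suc i) (suc j) = punchIn-<ᵇ a i j

punchIn-<ᵇ-pivot : ∀ {m} (a : Fin (suc m)) (i : Fin m) →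
  (toℕ (punchIn a i) ℕ.<ᵇ toℕ a) ≡ (toℕ i ℕ.<ᵇ toℕ a)
punchIn-<ᵇ-pivot zero    i       = refl
punchIn-<ᵇ-pivot (suc a) zero    = refl
punchIn-<ᵇ-pivot (suc a) (suc i) = punchIn-<ᵇ-pivot a i

module _ where
  open Summation ℕ.+-*-commutativeSemiring
  open ≡.≡-Reasoning

  private
    [_] : Bool → ℕ
    [ b ] = if b then 1 else 0

  length-filterᵇ : ∀ {a} {A : Set a} (p : A → Bool) xs → length (filterᵇ p xs) ≡ ∑ˡ xs (λ x → [ p x ])
  length-filterᵇ p []       = refl
  length-filterᵇ p (x ∷ xs) with p x
  ... | true  = cong suc (length-filterᵇ p xs)
  ... | false = length-filterᵇ p xs

  inversions-∑ : ∀ {m} (τ : Fin m → Fin m) →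
    inversions τ ≡ (∑[ i ] ∑[ j ] [ (toℕ i ℕ.<ᵇ toℕ j) ∧ (toℕ (τ j) ℕ.<ᵇ toℕ (τ i)) ])
  inversions-∑ {m} τ = ≡.trans (length-filterᵇ _ (pairs m)) (∑-pairs m _)

  inversions-cong : ∀ {m} {τ ρ : Fin m → Fin m} → τ ≗ ρ → inversions τ ≡ inversions ρ
  inversions-cong {m} {τ} {ρ} τ≗ρ = begin
    inversions τ
      ≡⟨ inversions-∑ τ ⟩
    (∑[ i ] ∑[ j ] [ (toℕ i ℕ.<ᵇ toℕ j) ∧ (toℕ (τ j) ℕ.<ᵇ toℕ (τ i)) ])
      ≡⟨ ∑-cong (λ i → ∑-cong λ j → cong₂ (λ k l → [ (toℕ i ℕ.<ᵇ toℕ j) ∧ (toℕ k ℕ.<ᵇ toℕ l) ])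
           (τ≗ρ j) (τ≗ρ i)) ⟩
    (∑[ i ] ∑[ j ] [ (toℕ i ℕ.<ᵇ toℕ j) ∧ (toℕ (ρ j) ℕ.<ᵇ toℕ (ρ i)) ])
      ≡⟨ inversions-∑ ρ ⟨
    inversions ρ ∎

  ∑-below : ∀ {m} (a : Fin (suc m)) → (∑[ i ] [ toℕ {m} i ℕ.<ᵇ toℕ a ]) ≡ toℕ a
  ∑-below zero = ∑-vanish λ i → refl
  ∑-below {suc m} (suc a) = ≡.trans (∑-suc _) (cong suc (∑-below a))

  -- The inversions involving the position zero are the later values below `a`; as `g` is a
  -- bijection, there are `toℕ a` of them. All others are inversions of `g`, because `punchIn a`
  -- preserves order.
  inversions-∷ : ∀ {m} (a : Fin (suc m)) (g : Fin m → Fin m) → Injective _≡_ _≡_ g →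
    inversions (a ∷ᶠ (punchIn a ∘ g)) ≡ toℕ a ℕ.+ inversions g
  inversions-∷ {m} a g inj = begin
    inversions τ
      ≡⟨ inversions-∑ τ ⟩
    (∑[ i ] ∑[ j ] inv i j)
      ≡⟨ ∑-suc _ ⟩
    (∑[ j ] inv zero j) ℕ.+ (∑[ i ] ∑[ j ] inv (suc i) j)
      -- The split-off terms `inv zero zero` and `inv (suc i) zero` compute to 0.
      ≡⟨ cong₂ ℕ._+_ (∑-suc _) (∑-cong λ i → ∑-suc (inv (suc i))) ⟩
    (∑[ j ] [ toℕ (punchIn a (g j)) ℕ.<ᵇ toℕ a ]) ℕ.+ (∑[ i ] ∑[ j ] inv (suc i) (suc j))
      ≡⟨ cong₂ ℕ._+_ (∑-cong λ j → cong [_] (punchIn-<ᵇ-pivot a (g j)))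
           (∑-cong λ i → ∑-cong λ j → cong (λ b → [ (toℕ i ℕ.<ᵇ toℕ j) ∧ b ]) (punchIn-<ᵇ a (g j) (g i))) ⟩
    (∑[ j ] [ toℕ (g j) ℕ.<ᵇ toℕ a ]) ℕ.+ (∑[ i ] ∑[ j ] [ (toℕ i ℕ.<ᵇ toℕ j) ∧ (toℕ (g j) ℕ.<ᵇ toℕ (g i)) ])
      ≡⟨ cong₂ ℕ._+_ (≡.trans (∑-∘-injective g inj (λ i → [ toℕ i ℕ.<ᵇ toℕ a ])) (∑-below a))
           (≡.sym (inversions-∑ g)) ⟩
    toℕ a ℕ.+ inversions g ∎
    where
    τ = a ∷ᶠ (punchIn a ∘ g)
    inv : Fin (suc m) → Fin (suc m) → ℕ
    inv i j = [ (toℕ i ℕ.<ᵇ toℕ j) ∧ (toℕ (τ j) ℕ.<ᵇ toℕ (τ i)) ]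

signPow-+ : ∀ m n → signPow (m ℕ.+ n) ≡ signPow m · signPow n
signPow-+ zero    n = refl
signPow-+ (suc m) n = ≡.trans (cong (Sign.- ·_) (signPow-+ m n)) (≡.sym (·-assoc Sign.- (signPow m) (signPow n)))

sign-∷ : ∀ {m} (a : Fin (suc m)) (g : Fin m → Fin m) → Injective _≡_ _≡_ g →
  sign (a ∷ᶠ (punchIn a ∘ g)) ≡ parity a · sign g
sign-∷ a g inj = ≡.trans (cong signPow (inversions-∷ a g inj)) (signPow-+ (toℕ a) (inversions g))

-- Every sign is its own inverse; this turns the sign condition on a permutation into the one that
-- `laplace` passes to its minors.
·-≟-transpose : ∀ p s σ → ⌊ p · s Sign.≟ σ ⌋ ≡ ⌊ s Sign.≟ p · σ ⌋
·-≟-transpose Sign.+ s      σ      = refl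
·-≟-transpose Sign.- Sign.+ Sign.+ = refl
·-≟-transpose Sign.- Sign.+ Sign.- = refl
·-≟-transpose Sign.- Sign.- Sign.+ = refl
·-≟-transpose Sign.- Sign.- Sign.- = refl

-- The derangement sum as a row expansion.

module DerangementSum {c ℓ} (F : ACField c ℓ) where
  open ACField F hiding (zero) renaming (refl to ≈-refl)
  open Summation (CommutativeRing.commutativeSemiring commRing)
  open Laplace commRing
  open SetoidReasoning setoid

  weight : ∀ {m n} → (Fin m → Fin n → Carrier) → (Fin m → Fin n) → Carrier
  weight {m} b τ = prodL F (map (λ j → b j (τ j)) (allFin m))

  -- Ranges over all permutations, fixed points included: a minor of a matrix with zero diagonal can
  -- have a nonzero diagonal, so the restriction to derangements would not survive the recursion.
  signedWeight : ∀ {m} → Matrix m → Sign → (Fin m → Fin m) → Carrier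
  signedWeight b σ τ = if isPermᵇ τ ∧ ⌊ sign τ Sign.≟ σ ⌋ then weight b τ else 0#

  prodL-zero : ∀ {a} {A : Set a} (f : A → Carrier) {xs x} → x ∈ xs → f x ≈ 0# → prodL F (map f xs) ≈ 0#
  prodL-zero f (here refl)   fx≈0 = trans (*-congʳ fx≈0) (zeroˡ _)
  prodL-zero f (there x∈xs) fx≈0 = trans (*-congˡ (prodL-zero f x∈xs fx≈0)) (zeroʳ _)

  weight-fixed-point : ∀ {m} {b : Matrix m} → (∀ i → b i i ≈ 0#) → ∀ τ →
    fixedPointFreeᵇ τ ≡ false → weight b τ ≈ 0#
  weight-fixed-point {m} {b} diagonal τ fixed with allᵇ-witness _ (allFin m) fixed
  ... | j , eq with τ j Fin.≟ j
  ...   | yes τj≡j = prodL-zero (λ j → b j (τ j)) (∈-allFin j) (trans (reflexive (cong (b j) τj≡j)) (diagonal j))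

  weight-∷ : ∀ {m n} (b : Fin (suc m) → Fin n → Carrier) a (f : Fin m → Fin n) →
    weight b (a ∷ᶠ f) ≡ b zero a * weight (b ∘ suc) f
  weight-∷ b a f = cong (λ xs → b zero a * prodL F xs)
    (≡.trans (map-tabulate suc (λ j → b j ((a ∷ᶠ f) j))) (≡.sym (map-tabulate id (λ j → b (suc j) (f j)))))

  signedWeight-cong : ∀ {m} (b : Matrix m) σ {τ ρ} → τ ≗ ρ → signedWeight b σ τ ≡ signedWeight b σ ρ
  signedWeight-cong {m} b σ τ≗ρ
    rewrite isPermᵇ-cong τ≗ρ | inversions-cong τ≗ρ
    = cong (if _ then_else 0#) (cong (prodL F) (map-cong (λ j → cong (b j) (τ≗ρ j)) (allFin m)))

  signedWeight-∷ : ∀ {m} (b : Matrix (suc m)) σ a g →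
    signedWeight b σ (a ∷ᶠ (punchIn a ∘ g)) ≈ b zero a * signedWeight (minor zero a b) (parity a · σ) g
  signedWeight-∷ b σ a g with isPermᵇ g in perm | isPermᵇ-∷ a g
  ... | false | eq rewrite eq = sym (zeroʳ _)
  ... | true  | eq rewrite eq | sign-∷ a g (isPermᵇ-sound g perm) | ·-≟-transpose (parity a) (sign g) σ
    with ⌊ sign g Sign.≟ parity a · σ ⌋
  ...   | true  = reflexive (weight-∷ b a (punchIn a ∘ g))
  ...   | false = sym (zeroʳ _)

  signedWeight-collision : ∀ {m} (b : Matrix (suc m)) σ a f (j : Fin m) → f j ≡ a →
    signedWeight b σ (a ∷ᶠ f) ≈ 0#
  signedWeight-collision b σ a f j fj≡a
    rewrite isPermᵇ-repeat (a ∷ᶠ f) {zero} {suc j} (λ ()) (≡.sym fj≡a) = ≈-refl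

  -- Choose the value `a` at zero. Tails that hit `a` again give no permutation, and the remaining
  -- tails are `punchIn a ∘ g`, on which sign and weight split as in the definition of `laplace`.
  ∑-signedWeight : ∀ m (b : Matrix m) σ → ∑ˡ (allFunctions m m) (signedWeight b σ) ≈ laplace b σ
  ∑-signedWeight zero    b Sign.+ = +-identityʳ 1#
  ∑-signedWeight zero    b Sign.- = +-identityʳ 0#
  ∑-signedWeight (suc m) b σ = begin
    ∑ˡ (allFunctions (suc m) (suc m)) (signedWeight b σ)
      ≈⟨ ∑-allFunctions m (suc m) (signedWeight b σ) ⟩
    (∑[ a ] ∑ˡ (allFunctions m (suc m)) (λ f → signedWeight b σ (a ∷ᶠ f)))
      ≈⟨ ∑-cong (λ a → ∑-allFunctions-punchIn m a (λ f → signedWeight b σ (a ∷ᶠ f))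
           (λ f≗g → reflexive (signedWeight-cong b σ λ { zero → refl ; (suc i) → f≗g i }))
           (signedWeight-collision b σ a)) ⟩
    (∑[ a ] ∑ˡ (allFunctions m m) (λ g → signedWeight b σ (a ∷ᶠ (punchIn a ∘ g))))
      ≈⟨ ∑-cong (λ a → ∑ˡ-cong (allFunctions m m) (signedWeight-∷ b σ a)) ⟩
    (∑[ a ] ∑ˡ (allFunctions m m) (λ g → b zero a * signedWeight (minor zero a b) (parity a · σ) g))
      ≈⟨ ∑-cong (λ a → *-distribˡ-∑ˡ (b zero a) (allFunctions m m) _) ⟩
    (∑[ a ] b zero a * ∑ˡ (allFunctions m m) (signedWeight (minor zero a b) (parity a · σ)))
      ≈⟨ ∑-cong (λ a → *-congˡ (∑-signedWeight m (minor zero a b) (parity a · σ))) ⟩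
    laplace b σ ∎

  derangementSum-laplace : ∀ {m} {b : Matrix m} → (∀ i → b i i ≈ 0#) → ∀ σ →
    derangementSum F b σ ≈ laplace b σ
  derangementSum-laplace {m} {b} diagonal σ = begin
    derangementSum F b σ
      ≈⟨ ∑ˡ-filterᵇ _ (derangements m) (weight b) ⟩
    ∑ˡ (derangements m) (λ τ → if ⌊ sign τ Sign.≟ σ ⌋ then weight b τ else 0#)
      ≈⟨ ∑ˡ-filterᵇ _ (allFunctions m m) _ ⟩
    ∑ˡ (allFunctions m m) (λ τ → if isPermᵇ τ ∧ fixedPointFreeᵇ τ
      then (if ⌊ sign τ Sign.≟ σ ⌋ then weight b τ else 0#) else 0#)
      ≈⟨ ∑ˡ-cong (allFunctions m m) drop-fixedPointFree ⟩
    ∑ˡ (allFunctions m m) (signedWeight b σ)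
      ≈⟨ ∑-signedWeight m b σ ⟩
    laplace b σ ∎
    where
    drop-fixedPointFree : ∀ τ → (if isPermᵇ τ ∧ fixedPointFreeᵇ τ
      then (if ⌊ sign τ Sign.≟ σ ⌋ then weight b τ else 0#) else 0#) ≈ signedWeight b σ τ
    drop-fixedPointFree τ with isPermᵇ τ | fixedPointFreeᵇ τ in fixed | ⌊ sign τ Sign.≟ σ ⌋
    ... | false | _     | _     = ≈-refl
    ... | true  | true  | _     = ≈-refl
    -- A permutation with a fixed point has a diagonal entry, hence zero, as a factor.
    ... | true  | false | true  = sym (weight-fixed-point {b = b} diagonal τ fixed)
    ... | true  | false | false = ≈-refl

-- The three-term relation for the given matrix.

module CauchyMatrix {c ℓ} (F : ACField c ℓ) where
  open ACField F hiding (zero) renaming (refl to ≈-refl)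
  open Laplace commRing
  open CommutativeSemigroupProperties *-commutativeSemigroup using () renaming (x∙yz≈y∙xz to *-swap)
  open RingProperties (CommutativeRing.ring commRing)
  open SetoidReasoning setoid

  *-cancelʳ-nonzero : ∀ {u v w} → ¬ w ≈ 0# → u * w ≈ v * w → u ≈ v
  *-cancelʳ-nonzero {u} {v} {w} w≉0 uw≈vw = begin
    u               ≈⟨ *-identityʳ u ⟨
    u * 1#          ≈⟨ *-congˡ (inv-correct w w≉0) ⟨
    u * (w * inv w) ≈⟨ *-assoc u w (inv w) ⟨
    u * w * inv w   ≈⟨ *-congʳ uw≈vw ⟩
    v * w * inv w   ≈⟨ *-assoc v w (inv w) ⟩
    v * (w * inv w) ≈⟨ *-congˡ (inv-correct w w≉0) ⟩
    v * 1#          ≈⟨ *-identityʳ v ⟩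
    v               ∎

  pow-+ : ∀ x m n → pow F x (m ℕ.+ n) ≈ pow F x m * pow F x n
  pow-+ x zero    n = sym (*-identityˡ _)
  pow-+ x (suc m) n = trans (*-congˡ (pow-+ x m n)) (sym (*-assoc _ _ _))

  pow-nonzero : ∀ {x} → ¬ x ≈ 0# → ∀ m → ¬ pow F x m ≈ 0#
  pow-nonzero x≉0 zero    1≈0 = 0≉1 (sym 1≈0)
  pow-nonzero {x} x≉0 (suc m) xᵐ⁺¹≈0 = x≉0 (*-cancelʳ-nonzero (pow-nonzero x≉0 m)
    (trans xᵐ⁺¹≈0 (sym (zeroˡ _))))

  pow-inv : ∀ {x} → ¬ x ≈ 0# → ∀ m → pow F (inv x) m * pow F x m ≈ 1#
  pow-inv x≉0 zero    = *-identityˡ 1#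
  pow-inv {x} x≉0 (suc m) = begin
    inv x * pow F (inv x) m * (x * pow F x m)   ≈⟨ *-assoc _ _ _ ⟩
    inv x * (pow F (inv x) m * (x * pow F x m)) ≈⟨ *-congˡ (*-swap _ _ _) ⟩
    inv x * (x * (pow F (inv x) m * pow F x m)) ≈⟨ *-congˡ (*-congˡ (pow-inv x≉0 m)) ⟩
    inv x * (x * 1#)                            ≈⟨ *-congˡ (*-identityʳ x) ⟩
    inv x * x                                   ≈⟨ *-comm _ _ ⟩
    x * inv x                                   ≈⟨ inv-correct x x≉0 ⟩
    1#                                          ∎

  powℤ-⊖ : ∀ {x} → ¬ x ≈ 0# → ∀ m n → powℤ F x (m ℤ.⊖ n) * pow F x n ≈ pow F x m
  powℤ-⊖ x≉0 m       zero    = *-identityʳ _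
  powℤ-⊖ x≉0 zero    (suc n) = pow-inv x≉0 (suc n)
  powℤ-⊖ {x} x≉0 (suc m) (suc n) rewrite ℤ.[1+m]⊖[1+n]≡m⊖n m n =
    trans (*-swap _ _ _) (*-congˡ (powℤ-⊖ x≉0 m n))

  -- Cancelling the power `i` would give `x` the power 1 at the exponent `j ∸ i`, which lies between
  -- 1 and `n - 1`.
  pow-distinct : ∀ {x n} → ¬ x ≈ 0# → (∀ m → 1 ℕ.≤ m → m ℕ.< n → ¬ pow F x m ≈ 1#) →
    ∀ {i j} → i ℕ.< j → j ℕ.< n → ¬ pow F x j ≈ pow F x i
  pow-distinct {x} {n} x≉0 xᵐ≉1 {i} {j} i<j j<n xʲ≈xⁱ =
    xᵐ≉1 (j ℕ.∸ i) (ℕ.m<n⇒0<n∸m i<j) (ℕ.≤-<-trans (ℕ.m∸n≤m j i) j<n)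
      (*-cancelʳ-nonzero (pow-nonzero x≉0 i) (begin
        pow F x (j ℕ.∸ i) * pow F x i ≈⟨ pow-+ x (j ℕ.∸ i) i ⟨
        pow F x (j ℕ.∸ i ℕ.+ i)       ≡⟨ cong (pow F x) (ℕ.m∸n+n≡m (ℕ.<⇒≤ i<j)) ⟩
        pow F x j                     ≈⟨ xʲ≈xⁱ ⟩
        pow F x i                     ≈⟨ *-identityˡ _ ⟨
        1# * pow F x i                ∎))

  *-nested-cancel : ∀ {u v e f g} → ¬ e ≈ 0# → ¬ f ≈ 0# → ¬ g ≈ 0# → u * e * f * g ≈ v * e * f * g → u ≈ v
  *-nested-cancel e≉0 f≉0 g≉0 = *-cancelʳ-nonzero e≉0 ∘ *-cancelʳ-nonzero f≉0 ∘ *-cancelʳ-nonzero g≉0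

  -- The identity y/(y − z) = P/(P − 1) for y = P z, cleared of denominators.
  one-minus-inverse : ∀ {P y z} → P * z ≈ y → ¬ 1# - P ≈ 0# → (1# - inv (1# - P)) * (y - z) ≈ y
  one-minus-inverse {P} {y} {z} Pz≈y v≉0 = begin
    B * (y - z)      ≈⟨ *-congˡ y-z ⟩
    B * - (v * z)    ≈⟨ -‿distribʳ-* B (v * z) ⟨
    - (B * (v * z))  ≈⟨ -‿cong (*-assoc B v z) ⟨
    - (B * v * z)    ≈⟨ -‿distribˡ-* (B * v) z ⟩
    - (B * v) * z    ≈⟨ *-congʳ (-‿cong Bv) ⟩
    - - P * z        ≈⟨ *-congʳ (-‿involutive P) ⟩
    P * z            ≈⟨ Pz≈y ⟩
    y                ∎
    where
    v = 1# - P
    B = 1# - inv v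
    Bv : B * v ≈ - P
    Bv = begin
      (1# - inv v) * v    ≈⟨ [y-z]x≈yx-zx v 1# (inv v) ⟩
      1# * v - inv v * v  ≈⟨ +-cong (*-identityˡ v) (-‿cong (trans (*-comm _ _) (inv-correct v v≉0))) ⟩
      1# - P - 1#         ≈⟨ xyx⁻¹≈y 1# (- P) ⟩
      - P                 ∎
    y-z : y - z ≈ - (v * z)
    y-z = begin
      y - z            ≈⟨ +-cong (sym Pz≈y) (-‿cong (sym (*-identityˡ z))) ⟩
      P * z - 1# * z   ≈⟨ [y-z]x≈yx-zx z P 1# ⟨
      (P - 1#) * z     ≈⟨ *-congʳ (trans (+-comm P (- 1#)) (trans (+-congˡ (sym (-‿involutive P))) (-‿+-comm 1# (- P)))) ⟩
      - v * z          ≈⟨ -‿distribˡ-* v z ⟨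
      - (v * z)        ∎

  -- For p = b i k, q = b k j, r = b k i, s = b i j the denominators are f = y i - y k,
  -- e = y k - y j and e + f = y i - y j.
  exchange-cleared : ∀ {p q r s a c e f} → p * f ≈ a → q * e ≈ c → r * f + c ≈ 0# → s * (e + f) ≈ a →
    (p * q + r * s) * e * f * (e + f) ≈ q * s * e * f * (e + f)
  exchange-cleared {p} {q} {r} {s} {a} {c} {e} {f} pf≈a qe≈c rf+c≈0 sg≈a = begin
    (p * q + r * s) * e * f * (e + f)
      ≈⟨ solve 6 (λ p q r s e f → (p :* q :+ r :* s) :* e :* f :* (e :+ f) :=
           (p :* f) :* (q :* e) :* (e :+ f) :+ (r :* f) :* (s :* (e :+ f)) :* e) ≈-refl p q r s e f ⟩
    p * f * (q * e) * (e + f) + r * f * (s * (e + f)) * e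
      ≈⟨ +-cong (*-congʳ (*-cong pf≈a qe≈c)) (*-congʳ (*-congˡ sg≈a)) ⟩
    a * c * (e + f) + r * f * a * e
      -- Isolates `r * f + c`. The relation for `r` is stated as a vanishing sum because the
      -- semiring solver knows no subtraction.
      ≈⟨ solve 5 (λ a c e f k → a :* c :* (e :+ f) :+ k :* a :* e := a :* c :* f :+ a :* e :* (k :+ c))
           ≈-refl a c e f (r * f) ⟩
    a * c * f + a * e * (r * f + c)
      ≈⟨ +-congˡ (trans (*-congˡ rf+c≈0) (zeroʳ _)) ⟩
    a * c * f + 0#
      ≈⟨ +-identityʳ _ ⟩
    a * c * f
      ≈⟨ *-congʳ (*-cong (sym sg≈a) (sym qe≈c)) ⟩
    s * (e + f) * (q * e) * f
      ≈⟨ solve 4 (λ q s e f → s :* (e :+ f) :* (q :* e) :* f := q :* s :* e :* f :* (e :+ f)) ≈-refl q s e f ⟩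
    q * s * e * f * (e + f) ∎
    where open SemiringSolver (CommutativeRing.commutativeSemiring commRing)

  telescope : ∀ a b c → (c - b) + (a - c) ≈ a - b
  telescope a b c = begin
    (c - b) + (a - c)      ≈⟨ +-comm _ _ ⟩
    (a - c) + (c - b)      ≈⟨ +-assoc _ _ _ ⟩
    a + (- c + (c - b))    ≈⟨ +-congˡ (\\-leftDividesʳ c (- b)) ⟩
    a - b                  ∎

  matA-diagonal : ∀ {n x} (i : Fin n) → matA F x i i ≈ 0#
  matA-diagonal i with i Fin.≟ i
  ... | yes _  = ≈-refl
  ... | no i≢i = contradiction refl i≢i

  module _ {n x} (x≉0 : ¬ x ≈ 0#) (xᵐ≉1 : ∀ m → 1 ℕ.≤ m → m ℕ.< n → ¬ pow F x m ≈ 1#) where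

    y : Fin n → Carrier
    y i = pow F x (toℕ i)

    y-injective : ∀ {i j} → y i ≈ y j → i ≡ j
    y-injective {i} {j} yi≈yj with Fin.<-cmp i j
    ... | tri< i<j _ _ = contradiction (sym yi≈yj) (pow-distinct x≉0 xᵐ≉1 i<j (toℕ<n j))
    ... | tri≈ _ i≡j _ = i≡j
    ... | tri> _ _ j<i = contradiction yi≈yj (pow-distinct x≉0 xᵐ≉1 j<i (toℕ<n i))

    y-difference : ∀ {i j} → i ≢ j → ¬ y i - y j ≈ 0#
    y-difference i≢j d≈0 = i≢j (y-injective (x∙y⁻¹≈ε⇒x≈y _ _ d≈0))

    -- With `P` the power of `x` at the index difference, `P * y j ≈ y i`, so the entry
    -- `1 - 1/(1 - P) = P/(P - 1)` becomes `y i / (y i - y j)`.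
    matA-off-diagonal : ∀ {i j} → i ≢ j → matA F x i j * (y i - y j) ≈ y i
    matA-off-diagonal {i} {j} i≢j with i Fin.≟ j
    ... | yes i≡j = contradiction i≡j i≢j
    -- `inv` is specified only at nonzero arguments; `P = 1` would force `y i ≈ y j`.
    ... | no _    = one-minus-inverse (powℤ-⊖ x≉0 (toℕ i) (toℕ j)) λ 1-P≈0 →
      i≢j (y-injective (trans (sym (powℤ-⊖ x≉0 (toℕ i) (toℕ j)))
        (trans (*-congʳ (sym (x∙y⁻¹≈ε⇒x≈y _ _ 1-P≈0))) (*-identityˡ _))))

    matA-ThreeTerm : ThreeTerm (matA F {n} x)
    matA-ThreeTerm .ThreeTerm.diagonal = matA-diagonal
    matA-ThreeTerm .ThreeTerm.exchange {i} {j} {k} i≢j j≢k i≢k =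
      *-nested-cancel (y-difference (j≢k ∘ ≡.sym)) (y-difference i≢k)
        -- The third denominator appears as the sum `e + f`, so its nonvanishing comes from that of
        -- `y i - y j` by telescoping.
        (λ g≈0 → y-difference i≢j (trans (sym (telescope (y i) (y j) (y k))) g≈0))
        (exchange-cleared (matA-off-diagonal i≢k) (matA-off-diagonal (j≢k ∘ ≡.sym)) rf+c≈0
          (trans (*-congˡ (telescope (y i) (y j) (y k))) (matA-off-diagonal i≢j)))
      where
      r = matA F x k i
      rf+c≈0 : r * (y i - y k) + y k ≈ 0#
      rf+c≈0 = begin
        r * (y i - y k) + y k      ≈⟨ +-congʳ (*-congˡ (sym (⁻¹-anti-homo‿- (y k) (y i)))) ⟩
        r * - (y k - y i) + y k    ≈⟨ +-congʳ (-‿distribʳ-* r _) ⟨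
        - (r * (y k - y i)) + y k  ≈⟨ +-congʳ (-‿cong (matA-off-diagonal (i≢k ∘ ≡.sym))) ⟩
        - y k + y k                ≈⟨ -‿inverseˡ (y k) ⟩
        0#                         ∎

-- Passage to the submatrix on the kept indices.

strictly-monotone⇒injective : ∀ {m n} (t : Fin m → Fin n) → (∀ i j → i Fin.< j → t i Fin.< t j) → Injective _≡_ _≡_ t
strictly-monotone⇒injective t mono {i} {j} ti≡tj with Fin.<-cmp i j
... | tri< i<j _ _ = contradiction ti≡tj (Fin.<⇒≢ (mono i j i<j))
... | tri≈ _ i≡j _ = i≡j
... | tri> _ _ j<i = contradiction (≡.sym ti≡tj) (Fin.<⇒≢ (mono j i j<i))

open import Data.Nat using (_+_)

theorem3p1 : ∀ {c ℓ} (F : ACField c ℓ) → 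
    (n : ℕ) → 1 ≤ n →
    (x : ACField.Carrier F) → ¬ (x ≈[ F ] ACField.0# F) → (∀ m → 1 ≤ m → m < n → ¬ (pow F x m ≈[ F ] ACField.1# F)) →
    (k : ℕ) → k < n →
    (s : Fin k → Fin n) → (∀ i j → i Fin.< j → s i Fin.< s j) →
    (t : Fin (n ∸ k) → Fin n) → (∀ i j → i Fin.< j → t i Fin.< t j) → (∀ i j → t i ≢ s j) →
    ((n ∸ k) % 2 ≡ 1 →
    (derangementSum F (λ i j → matA F x (t i) (t j)) Sign.+ ≈[ F ] ACField.0# F)
    × (derangementSum F (λ i j → matA F x (t i) (t j)) Sign.- ≈[ F ] ACField.0# F))
    × ((n ∸ k) % 2 ≡ 0 →
    derangementSum F (λ i j → matA F x (t i) (t j)) (signPow ((n ∸ k) / 2 + 1)) ≈[ F ] ACField.0# F)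
theorem3p1 F n _ x x≉0 xᵐ≉1 k _ _ _ t t-mono _ =
  (λ odd → odd-sum odd Sign.+ , odd-sum odd Sign.-) ,
  (λ even → trans (to-laplace _) (laplace-even-vanish (n ∸ k) b-ThreeTerm even))
  where
  open ACField F using (_≈_; 0#; trans; commRing)
  open Laplace commRing
  b : Matrix (n ∸ k)
  b i j = matA F x (t i) (t j)
  b-ThreeTerm : ThreeTerm b
  b-ThreeTerm = ThreeTerm-restrict t (strictly-monotone⇒injective t t-mono)
    (CauchyMatrix.matA-ThreeTerm F x≉0 xᵐ≉1)
  to-laplace : ∀ σ → derangementSum F b σ ≈ laplace b σ
  to-laplace = DerangementSum.derangementSum-laplace F (ThreeTerm.diagonal b-ThreeTerm)
  odd-sum : (n ∸ k) % 2 ≡ 1 → ∀ σ → derangementSum F b σ ≈ 0#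
  odd-sum odd σ = trans (to-laplace σ) (laplace-odd-vanish (n ∸ k) b-ThreeTerm odd σ)
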